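{- Let $F$ be a CNF formula over the finite set $X$ of variables, let $D=\{0,1,*\}$, let $s_F:X\times D\to\mathbb{R}_{\ge0}$ be a unitary weighting seed, and let $w_F(\sigma,x)=\omega_F(x,\sigma(x),A_F(\sigma,x))$ for every valid valuation $\sigma$ and $x\in X$, where $$\omega_F(x,a,\Delta)=\begin{cases}s_F(x,a)&\text{if }a=*\text{ and }a\in\Delta,\\ s_F(x,a)+\sum_{b\in D\setminus\Delta}s_F(x,b)&\text{if }a\ne *\text{ and }a\in\Delta,\\0&\text{if }a\notin\Delta.\end{cases}$$ If $F$ admits a boolean solution, then $\gamma(F)\ge1$, where $\gamma(F)=\sum_{\sigma\in\mathcal{S}(F)}\prod_{x\in X}w_F(\sigma,x)$.
   Context: Valuations are maps $X\to D=\{0,1,*\}$. Under a valuation, a literal is starred if its variable has value $*$; it is true if its variable has value $1$ and the literal is positive, or its variable has value $0$ and the literal is negative. A valuation is valid for $F$ iff each clause of $F$ contains at least one true literal or at least two starred literals. $\mathcal{S}(F)$ denotes the set of valid valuations of $F$. A boolean solution is a valid valuation with all values in $\{0,1\}$. For $\sigma\in\mathcal{S}(F)$ and $x\in X$, $A_F(\sigma,x)$ is the set of values $\tau(x)$ over all $\tau\in\mathcal{S}(F)$ agreeing with $\sigma$ on all variables other than $x$ (including $\tau=\sigma$). A weighting seed $s_F$ is unitary iff $s_F(x,0)+s_F(x,1)+s_F(x,*)=1$ for all $x\in X$. -}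

module Defs where

open import Data.Bool using (Bool; true; false)
import Data.Bool.Properties as Bool
open import Data.Fin using (Fin)
import Data.Fin.Properties as Fin
open import Data.List using (List; []; _∷_; map; filter; foldr; allFin; cartesianProductWith)
open import Data.List.Membership.Propositional using (_∈_; find; lose)
open import Data.List.Relation.Unary.All using (All; all?)
open import Data.List.Relation.Unary.Any using (any?)
open import Data.Nat as ℕ using (ℕ; zero; suc)
import Data.Nat.Properties as ℕ
open import Data.Product using (Σ-syntax; ∃-syntax; _×_; _,_)
open import Data.Product.Properties using (≡-dec)
open import Data.Rational as ℚ using (ℚ; 0ℚ; 1ℚ; ½; ∣_∣; positive; nonNegative)
import Data.Rational.Properties as ℚ
open import Algebra.Bundles using (CommutativeMonoid)
open import Algebra.Properties.CommutativeSemigroup (CommutativeMonoid.commutativeSemigroup ℚ.+-0-commutativeMonoid) using (interchange)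
open import Data.Sum using (_⊎_)
open import Data.Vec using (Vec; []; _∷_; lookup)
open import Relation.Binary.Definitions using (DecidableEquality)
open import Relation.Binary.PropositionalEquality using (_≡_; _≢_; refl; sym; trans; cong; cong₂)
open import Relation.Nullary using (Dec; yes; no)
open import Relation.Nullary.Decidable using (¬?; _×-dec_; _⊎-dec_; _→-dec_; map′)

------------------------------------------------------------------------
-- Real numbers: Cauchy sequences of rationals, with equality and order
-- defined on the sequences (a setoid in place of a quotient).

IsCauchy : (ℕ → ℚ) → Set
IsCauchy u = ∀ ε → 0ℚ ℚ.< ε →
  ∃[ N ] (∀ m n → N ℕ.≤ m → N ℕ.≤ n → ∣ u m ℚ.- u n ∣ ℚ.< ε)

record ℝ : Set where
  constructor mkℝ
  field
    seq    : ℕ → ℚ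
    cauchy : IsCauchy seq

open ℝ public

infix 4 _≈ᴿ_ _≤ᴿ_ _≥ᴿ_

_≈ᴿ_ : ℝ → ℝ → Set
x ≈ᴿ y = ∀ ε → 0ℚ ℚ.< ε →
  ∃[ N ] (∀ n → N ℕ.≤ n → ∣ seq x n ℚ.- seq y n ∣ ℚ.< ε)

_≤ᴿ_ : ℝ → ℝ → Set
x ≤ᴿ y = ∀ ε → 0ℚ ℚ.< ε →
  ∃[ N ] (∀ n → N ℕ.≤ n → seq x n ℚ.≤ seq y n ℚ.+ ε)

_≥ᴿ_ : ℝ → ℝ → Set
x ≥ᴿ y = y ≤ᴿ x

fromℚ : ℚ → ℝ
fromℚ q = mkℝ (λ _ → q) λ ε 0<ε → 0 , λ _ _ _ _ → begin-strict
  ∣ q ℚ.- q ∣ ≡⟨ cong ∣_∣ (ℚ.+-inverseʳ q) ⟩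
  0ℚ          <⟨ 0<ε ⟩
  ε           ∎
  where open ℚ.≤-Reasoning

0ᴿ 1ᴿ : ℝ
0ᴿ = fromℚ 0ℚ
1ᴿ = fromℚ 1ℚ

private
  half>0 : ∀ {ε} → 0ℚ ℚ.< ε → 0ℚ ℚ.< ½ ℚ.* ε
  half>0 {ε} 0<ε = ℚ.positive⁻¹ (½ ℚ.* ε) {{ℚ.pos*pos⇒pos ½ ε {{positive 0<ε}}}}

  half+half : ∀ ε → ½ ℚ.* ε ℚ.+ ½ ℚ.* ε ≡ ε
  half+half ε = trans (sym (ℚ.*-distribʳ-+ ε ½ ½)) (ℚ.*-identityˡ ε)

+-cauchy : ∀ {u v} → IsCauchy u → IsCauchy v → IsCauchy (λ n → u n ℚ.+ v n)
+-cauchy {u} {v} cu cv ε 0<ε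
  with cu (½ ℚ.* ε) (half>0 0<ε) | cv (½ ℚ.* ε) (half>0 0<ε)
... | M , hM | N , hN = M ℕ.⊔ N , λ m n m≥ n≥ → begin-strict
  ∣ (u m ℚ.+ v m) ℚ.- (u n ℚ.+ v n) ∣       ≡⟨ cong ∣_∣ (rearrange (u m) (v m) (u n) (v n)) ⟩
  ∣ (u m ℚ.- u n) ℚ.+ (v m ℚ.- v n) ∣       ≤⟨ ℚ.∣p+q∣≤∣p∣+∣q∣ (u m ℚ.- u n) (v m ℚ.- v n) ⟩
  ∣ u m ℚ.- u n ∣ ℚ.+ ∣ v m ℚ.- v n ∣       <⟨ ℚ.+-mono-< (hM m n (ℕ.m⊔n≤o⇒m≤o M N m≥) (ℕ.m⊔n≤o⇒m≤o M N n≥))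
                                                         (hN m n (ℕ.m⊔n≤o⇒n≤o M N m≥) (ℕ.m⊔n≤o⇒n≤o M N n≥)) ⟩
  ½ ℚ.* ε ℚ.+ ½ ℚ.* ε                       ≡⟨ half+half ε ⟩
  ε                                         ∎
  where
  open ℚ.≤-Reasoning
  rearrange : ∀ a b c d → (a ℚ.+ b) ℚ.- (c ℚ.+ d) ≡ (a ℚ.- c) ℚ.+ (b ℚ.- d)
  rearrange a b c d = trans (cong (a ℚ.+ b ℚ.+_) (ℚ.neg-distrib-+ c d))
                            (interchange a b (ℚ.- c) (ℚ.- d))

cauchy-bounded : ∀ {u} → IsCauchy u →
  ∃[ B ] (0ℚ ℚ.< B × ∃[ N ] (∀ n → N ℕ.≤ n → ∣ u n ∣ ℚ.≤ B))
cauchy-bounded {u} cu with cu 1ℚ (ℚ.positive⁻¹ 1ℚ)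
... | N , hN = 1ℚ ℚ.+ ∣ u N ∣
  , ℚ.+-mono-<-≤ (ℚ.positive⁻¹ 1ℚ) (ℚ.0≤∣p∣ (u N))
  , N , λ n n≥ → begin
  ∣ u n ∣                         ≡⟨ cong ∣_∣ (split (u n) (u N)) ⟩
  ∣ (u n ℚ.- u N) ℚ.+ u N ∣       ≤⟨ ℚ.∣p+q∣≤∣p∣+∣q∣ (u n ℚ.- u N) (u N) ⟩
  ∣ u n ℚ.- u N ∣ ℚ.+ ∣ u N ∣     ≤⟨ ℚ.+-monoˡ-≤ ∣ u N ∣ (ℚ.<⇒≤ (hN n N n≥ ℕ.≤-refl)) ⟩
  1ℚ ℚ.+ ∣ u N ∣                  ∎
  where
  open ℚ.≤-Reasoning
  split : ∀ a b → a ≡ (a ℚ.- b) ℚ.+ b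
  split a b = begin-equality
    a                          ≡⟨ ℚ.+-identityʳ a ⟨
    a ℚ.+ 0ℚ                   ≡⟨ cong (a ℚ.+_) (ℚ.+-inverseˡ b) ⟨
    a ℚ.+ (ℚ.- b ℚ.+ b)        ≡⟨ ℚ.+-assoc a (ℚ.- b) b ⟨
    (a ℚ.- b) ℚ.+ b            ∎

private
  -- δ > 0 with B * δ ≡ ½ * ε
  shrink : ∀ B ε → 0ℚ ℚ.< B → 0ℚ ℚ.< ε → Σ[ δ ∈ ℚ ] (0ℚ ℚ.< δ × B ℚ.* δ ≡ ½ ℚ.* ε)
  shrink B ε 0<B 0<ε = δ , ℚ.positive⁻¹ δ {{δ-pos}} , eq
    where
    instance
      B-pos : ℚ.Positive B
      B-pos = positive 0<B
      B≢0 : ℚ.NonZero B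
      B≢0 = ℚ.pos⇒nonZero B
      B⁻¹-pos : ℚ.Positive (ℚ.1/ B)
      B⁻¹-pos = ℚ.1/pos⇒pos B
      ½ε-pos : ℚ.Positive (½ ℚ.* ε)
      ½ε-pos = positive (half>0 0<ε)
    δ : ℚ
    δ = ℚ.1/ B ℚ.* (½ ℚ.* ε)
    δ-pos : ℚ.Positive δ
    δ-pos = ℚ.pos*pos⇒pos (ℚ.1/ B) (½ ℚ.* ε)
    eq : B ℚ.* δ ≡ ½ ℚ.* ε
    eq = trans (sym (ℚ.*-assoc B (ℚ.1/ B) (½ ℚ.* ε)))
        (trans (cong (ℚ._* (½ ℚ.* ε)) (ℚ.*-inverseʳ B)) (ℚ.*-identityˡ (½ ℚ.* ε)))

  -- |a| ≤ B and |d| < δ give |a * d| ≤ B * δ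
  ∣*∣-bound : ∀ a d B δ → 0ℚ ℚ.< B → ∣ a ∣ ℚ.≤ B → ∣ d ∣ ℚ.< δ → ∣ a ℚ.* d ∣ ℚ.≤ B ℚ.* δ
  ∣*∣-bound a d B δ 0<B a≤B d<δ = begin
    ∣ a ℚ.* d ∣       ≡⟨ ℚ.∣p*q∣≡∣p∣*∣q∣ a d ⟩
    ∣ a ∣ ℚ.* ∣ d ∣   ≤⟨ ℚ.*-monoʳ-≤-nonNeg ∣ d ∣ {{nonNegative (ℚ.0≤∣p∣ d)}} a≤B ⟩
    B ℚ.* ∣ d ∣       ≤⟨ ℚ.*-monoˡ-≤-nonNeg B {{nonNegative (ℚ.<⇒≤ 0<B)}} (ℚ.<⇒≤ d<δ) ⟩
    B ℚ.* δ           ∎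
    where open ℚ.≤-Reasoning

  telescope : ∀ p q r → (p ℚ.- q) ℚ.+ (q ℚ.- r) ≡ p ℚ.- r
  telescope p q r = begin-equality
    (p ℚ.- q) ℚ.+ (q ℚ.- r)          ≡⟨ ℚ.+-assoc p (ℚ.- q) (q ℚ.- r) ⟩
    p ℚ.+ (ℚ.- q ℚ.+ (q ℚ.- r))      ≡⟨ cong (p ℚ.+_) (ℚ.+-assoc (ℚ.- q) q (ℚ.- r)) ⟨
    p ℚ.+ ((ℚ.- q ℚ.+ q) ℚ.- r)      ≡⟨ cong (λ z → p ℚ.+ (z ℚ.- r)) (ℚ.+-inverseˡ q) ⟩
    p ℚ.+ (0ℚ ℚ.- r)                 ≡⟨ cong (p ℚ.+_) (ℚ.+-identityˡ (ℚ.- r)) ⟩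
    p ℚ.- r                          ∎
    where open ℚ.≤-Reasoning

  *-distribˡ-sub : ∀ p q r → p ℚ.* q ℚ.- p ℚ.* r ≡ p ℚ.* (q ℚ.- r)
  *-distribˡ-sub p q r = trans (cong (p ℚ.* q ℚ.+_) (ℚ.neg-distribʳ-* p r))
                               (sym (ℚ.*-distribˡ-+ p q (ℚ.- r)))

*-cauchy : ∀ {u v} → IsCauchy u → IsCauchy v → IsCauchy (λ n → u n ℚ.* v n)
*-cauchy {u} {v} cu cv ε 0<ε
  with cauchy-bounded {u} cu | cauchy-bounded {v} cv
... | A , 0<A , Nᵤ , u≤A | B , 0<B , Nᵥ , v≤B
  with shrink A (½ ℚ.* ε) 0<A (half>0 0<ε) | shrink B (½ ℚ.* ε) 0<B (half>0 0<ε)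
... | α , 0<α , Aα | β , 0<β , Bβ
  with cv α 0<α | cu β 0<β
... | M , hM | N , hN = K , λ m n m≥ n≥ → begin-strict
  ∣ u m ℚ.* v m ℚ.- u n ℚ.* v n ∣
    ≡⟨ cong ∣_∣ (rearrange (u m) (v m) (u n) (v n)) ⟩
  ∣ u m ℚ.* (v m ℚ.- v n) ℚ.+ v n ℚ.* (u m ℚ.- u n) ∣
    ≤⟨ ℚ.∣p+q∣≤∣p∣+∣q∣ (u m ℚ.* (v m ℚ.- v n)) (v n ℚ.* (u m ℚ.- u n)) ⟩
  ∣ u m ℚ.* (v m ℚ.- v n) ∣ ℚ.+ ∣ v n ℚ.* (u m ℚ.- u n) ∣
    ≤⟨ ℚ.+-mono-≤
         (∣*∣-bound (u m) (v m ℚ.- v n) A α 0<A (u≤A m (ℕ.≤-trans Nᵤ≤K m≥)) (hM m n (ℕ.≤-trans M≤K m≥) (ℕ.≤-trans M≤K n≥)))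
         (∣*∣-bound (v n) (u m ℚ.- u n) B β 0<B (v≤B n (ℕ.≤-trans Nᵥ≤K n≥)) (hN m n (ℕ.≤-trans N≤K m≥) (ℕ.≤-trans N≤K n≥))) ⟩
  A ℚ.* α ℚ.+ B ℚ.* β
    ≡⟨ cong₂ ℚ._+_ Aα Bβ ⟩
  ½ ℚ.* (½ ℚ.* ε) ℚ.+ ½ ℚ.* (½ ℚ.* ε)
    ≡⟨ half+half (½ ℚ.* ε) ⟩
  ½ ℚ.* ε
    ≡⟨ ℚ.+-identityʳ (½ ℚ.* ε) ⟨
  ½ ℚ.* ε ℚ.+ 0ℚ
    <⟨ ℚ.+-monoʳ-< (½ ℚ.* ε) (half>0 0<ε) ⟩
  ½ ℚ.* ε ℚ.+ ½ ℚ.* ε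
    ≡⟨ half+half ε ⟩
  ε ∎
  where
  open ℚ.≤-Reasoning
  K : ℕ
  K = (Nᵤ ℕ.⊔ Nᵥ) ℕ.⊔ (M ℕ.⊔ N)
  Nᵤ≤K : Nᵤ ℕ.≤ K
  Nᵤ≤K = ℕ.≤-trans (ℕ.m≤m⊔n Nᵤ Nᵥ) (ℕ.m≤m⊔n (Nᵤ ℕ.⊔ Nᵥ) (M ℕ.⊔ N))
  Nᵥ≤K : Nᵥ ℕ.≤ K
  Nᵥ≤K = ℕ.≤-trans (ℕ.m≤n⊔m Nᵤ Nᵥ) (ℕ.m≤m⊔n (Nᵤ ℕ.⊔ Nᵥ) (M ℕ.⊔ N))
  M≤K : M ℕ.≤ K
  M≤K = ℕ.≤-trans (ℕ.m≤m⊔n M N) (ℕ.m≤n⊔m (Nᵤ ℕ.⊔ Nᵥ) (M ℕ.⊔ N))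
  N≤K : N ℕ.≤ K
  N≤K = ℕ.≤-trans (ℕ.m≤n⊔m M N) (ℕ.m≤n⊔m (Nᵤ ℕ.⊔ Nᵥ) (M ℕ.⊔ N))
  rearrange : ∀ a b c d →
    a ℚ.* b ℚ.- c ℚ.* d ≡ a ℚ.* (b ℚ.- d) ℚ.+ d ℚ.* (a ℚ.- c)
  rearrange a b c d = begin-equality
    a ℚ.* b ℚ.- c ℚ.* d
      ≡⟨ telescope (a ℚ.* b) (a ℚ.* d) (c ℚ.* d) ⟨
    (a ℚ.* b ℚ.- a ℚ.* d) ℚ.+ (a ℚ.* d ℚ.- c ℚ.* d)
      ≡⟨ cong₂ ℚ._+_ (*-distribˡ-sub a b d)
                     (trans (cong₂ ℚ._-_ (ℚ.*-comm a d) (ℚ.*-comm c d)) (*-distribˡ-sub d a c)) ⟩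
    a ℚ.* (b ℚ.- d) ℚ.+ d ℚ.* (a ℚ.- c) ∎

infixl 6 _+ᴿ_
infixl 7 _*ᴿ_

_+ᴿ_ : ℝ → ℝ → ℝ
x +ᴿ y = mkℝ (λ n → seq x n ℚ.+ seq y n) (+-cauchy {seq x} {seq y} (cauchy x) (cauchy y))

_*ᴿ_ : ℝ → ℝ → ℝ
x *ᴿ y = mkℝ (λ n → seq x n ℚ.* seq y n) (*-cauchy {seq x} {seq y} (cauchy x) (cauchy y))

sumᴿ : List ℝ → ℝ
sumᴿ = foldr _+ᴿ_ 0ᴿ

productᴿ : List ℝ → ℝ
productᴿ = foldr _*ᴿ_ 1ᴿ

------------------------------------------------------------------------
-- CNF formulas over the variables X = Fin n

data D : Set where
  𝟘 𝟙 ⋆ : D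

_≟ᴰ_ : DecidableEquality D
𝟘 ≟ᴰ 𝟘 = yes refl
𝟘 ≟ᴰ 𝟙 = no λ ()
𝟘 ≟ᴰ ⋆ = no λ ()
𝟙 ≟ᴰ 𝟘 = no λ ()
𝟙 ≟ᴰ 𝟙 = yes refl
𝟙 ≟ᴰ ⋆ = no λ ()
⋆ ≟ᴰ 𝟘 = no λ ()
⋆ ≟ᴰ 𝟙 = no λ ()
⋆ ≟ᴰ ⋆ = yes refl

open import Data.List.Membership.DecPropositional _≟ᴰ_ using (_∈?_)

allD : List D
allD = 𝟘 ∷ 𝟙 ∷ ⋆ ∷ []

-- (x , true) is the positive literal x, (x , false) its negation.
Literal : ℕ → Set
Literal n = Fin n × Bool

_≟ᴸ_ : ∀ {n} → DecidableEquality (Literal n)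
_≟ᴸ_ = ≡-dec Fin._≟_ Bool._≟_

-- Lists stand for finite sets: clauses and formulas are only ever inspected
-- through membership, so order and repetitions are irrelevant.
Clause : ℕ → Set
Clause n = List (Literal n)

CNF : ℕ → Set
CNF n = List (Clause n)

Valuation : ℕ → Set
Valuation n = Vec D n

allValuations : ∀ n → List (Valuation n)
allValuations zero    = [] ∷ []
allValuations (suc n) = cartesianProductWith _∷_ allD (allValuations n)

Starred : ∀ {n} → Valuation n → Literal n → Set
Starred σ (x , _) = lookup σ x ≡ ⋆

True : ∀ {n} → Valuation n → Literal n → Set
True σ (x , b) = (lookup σ x ≡ 𝟙 × b ≡ true) ⊎ (lookup σ x ≡ 𝟘 × b ≡ false)

HasTrue : ∀ {n} → Valuation n → Clause n → Set
HasTrue σ C = ∃[ l ] (l ∈ C × True σ l)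

HasTwoStarred : ∀ {n} → Valuation n → Clause n → Set
HasTwoStarred σ C =
  ∃[ l ] (l ∈ C × ∃[ l′ ] (l′ ∈ C × l ≢ l′ × Starred σ l × Starred σ l′))

Valid : ∀ {n} → CNF n → Valuation n → Set
Valid F σ = All (λ C → HasTrue σ C ⊎ HasTwoStarred σ C) F

private
  ∃∈? : ∀ {A : Set} {P : A → Set} → (∀ a → Dec (P a)) → ∀ xs → Dec (∃[ a ] (a ∈ xs × P a))
  ∃∈? P? xs = map′ find (λ (_ , a∈xs , pa) → lose a∈xs pa) (any? P? xs)

starred? : ∀ {n} (σ : Valuation n) l → Dec (Starred σ l)
starred? σ (x , _) = lookup σ x ≟ᴰ ⋆

true? : ∀ {n} (σ : Valuation n) l → Dec (True σ l)
true? σ (x , b) =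
  (lookup σ x ≟ᴰ 𝟙 ×-dec b Bool.≟ true) ⊎-dec (lookup σ x ≟ᴰ 𝟘 ×-dec b Bool.≟ false)

valid? : ∀ {n} (F : CNF n) σ → Dec (Valid F σ)
valid? F σ = all? (λ C →
  ∃∈? (true? σ) C ⊎-dec
  ∃∈? (λ l → ∃∈? (λ l′ → ¬? (l ≟ᴸ l′) ×-dec starred? σ l ×-dec starred? σ l′) C) C) F

𝒮 : ∀ {n} → CNF n → List (Valuation n)
𝒮 {n} F = filter (valid? F) (allValuations n)

Boolean : ∀ {n} → Valuation n → Set
Boolean σ = ∀ x → lookup σ x ≡ 𝟘 ⊎ lookup σ x ≡ 𝟙

BooleanSolution : ∀ {n} → CNF n → Valuation n → Set
BooleanSolution F σ = Valid F σ × Boolean σ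

AgreeOff : ∀ {n} → Fin n → Valuation n → Valuation n → Set
AgreeOff x σ τ = ∀ y → y ≢ x → lookup τ y ≡ lookup σ y

agreeOff? : ∀ {n} (x : Fin n) (σ τ : Valuation n) → Dec (AgreeOff x σ τ)
agreeOff? x σ τ = Fin.all? (λ y → ¬? (y Fin.≟ x) →-dec (lookup τ y ≟ᴰ lookup σ y))

-- A_F(σ,x), as a list used only through membership.
A : ∀ {n} → CNF n → Valuation n → Fin n → List D
A F σ x = map (λ τ → lookup τ x) (filter (agreeOff? x σ) (𝒮 F))

------------------------------------------------------------------------
-- Weights

record WeightingSeed (n : ℕ) : Set where
  field
    weight : Fin n → D → ℝ
    nonneg : ∀ x a → weight x a ≥ᴿ 0ᴿ

open WeightingSeed public

Unitary : ∀ {n} → WeightingSeed n → Set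
Unitary s = ∀ x → weight s x 𝟘 +ᴿ weight s x 𝟙 +ᴿ weight s x ⋆ ≈ᴿ 1ᴿ

ω : ∀ {n} → WeightingSeed n → Fin n → D → List D → ℝ
ω s x a Δ with a ∈? Δ | a ≟ᴰ ⋆
... | yes _ | yes _ = weight s x a
... | yes _ | no  _ = weight s x a +ᴿ sumᴿ (map (weight s x) (filter (λ b → ¬? (b ∈? Δ)) allD))
... | no  _ | _     = 0ᴿ

w : ∀ {n} → CNF n → WeightingSeed n → Valuation n → Fin n → ℝ
w F s σ x = ω s x (lookup σ x) (A F σ x)

γ : ∀ {n} → CNF n → WeightingSeed n → ℝ
γ {n} F s = sumᴿ (map (λ σ → productᴿ (map (w F s σ) (allFin n))) (𝒮 F))

{-# OPTIONS --safe #-}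

-- Draw r ∈ D^X at random, the values r(x) being independent with law s(x,·).
-- Then w(σ,x) is the probability that r(x) = σ(x), or that σ(x) ≠ ⋆ and
-- r(x) ∉ A(σ,x); call r compatible with σ if this happens at every x. Hence
-- γ(F) is the expected number of valid σ compatible with r, and it suffices
-- that every r has one. Start from a boolean solution and, as long as some x
-- has σ(x) ≠ r(x) ∈ A(σ,x), change σ(x) to r(x). The number of disagreements
-- with r decreases, and a starred variable of σ always has r(x) = ⋆, so the
-- last σ is compatible with r.
module Submission where

open import Defs
open import Algebra.Bundles using (CommutativeSemiring)
import Algebra.Structures.Biased as Biased
open import Data.Bool using (true; false; if_then_else_)
open import Data.Empty using (⊥-elim)
open import Data.Fin using (Fin; zero; suc)
import Data.Fin.Properties as Fin
open import Data.List using (List; []; _∷_; _++_; map; filter; foldr; allFin; cartesianProductWith)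
open import Data.List.Membership.Propositional using (_∈_; _∉_)
open import Data.List.Membership.Propositional.Properties using (∈-map⁺; ∈-map⁻; ∈-filter⁺; ∈-filter⁻; ∈-cartesianProductWith⁺)
open import Data.List.Membership.DecPropositional _≟ᴰ_ using (_∈?_)
open import Data.List.Properties using (map-∘; map-tabulate)
open import Data.List.Relation.Unary.Any using (here; there)
open import Data.Nat as ℕ using (ℕ; zero; suc)
open import Data.Nat.Induction using (<-wellFounded)
import Data.Nat.Properties as ℕ
open import Data.Product using (∃-syntax; _×_; _,_; proj₂)
open import Data.Rational as ℚ using (0ℚ; 1ℚ; ½; ∣_∣; positive; nonNegative; nonPositive)
import Data.Rational.Properties as ℚ
open import Data.Rational.Solver using (module +-*-Solver)
open import Data.Sum using (_⊎_; inj₁; inj₂; [_,_]′)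
open import Data.Vec using ([]; _∷_; lookup)
import Data.Vec.Properties as Vec
open import Function using (_∘_)
open import Induction.WellFounded using (Acc; acc)
open import Relation.Binary.Bundles using (Preorder)
open import Relation.Binary.PropositionalEquality as ≡ using (_≡_; _≢_)
import Relation.Binary.Reasoning.Preorder
open import Relation.Binary.Structures using (IsEquivalence)
open import Relation.Unary using (Decidable)
open import Relation.Nullary using (¬_; Dec; yes; no; does)
open import Relation.Nullary.Decidable using (¬?; _×-dec_; _⊎-dec_; decidable-stable)

-- Here `a` is the value of a valuation at a variable, `Δ` the admissible values there and `b` the
-- drawn value. The second alternative mirrors the extra sum in `ω`: a boolean value also absorbs
-- the draws outside `Δ`.
Follows : D → List D → D → Set
Follows a Δ b = a ≡ b ⊎ (a ≢ ⋆ × b ∉ Δ)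

follows? : ∀ a Δ b → Dec (Follows a Δ b)
follows? a Δ b = a ≟ᴰ b ⊎-dec (¬? (a ≟ᴰ ⋆) ×-dec ¬? (b ∈? Δ))

-- Sums and products over lists

-- An abstract semiring keeps the operations opaque: none of these identities looks at the sequences
-- behind a real.
module ListSums {c ℓ} (R : CommutativeSemiring c ℓ) where
  open CommutativeSemiring R hiding (zero) renaming (Carrier to K; refl to ≈-refl)
  open import Algebra.Properties.CommutativeSemigroup +-commutativeSemigroup using (interchange; x∙yz≈y∙xz)
  open import Relation.Binary.Reasoning.Setoid setoid

  ∑ ∏ : ∀ {A : Set} → List A → (A → K) → K
  ∑ xs f = foldr _+_ 0# (map f xs)
  ∏ xs f = foldr _*_ 1# (map f xs)

  module _ {A : Set} where

    -- Equality is asked only on members of `xs`, because the weight of a valuation is rewritten as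
    -- a sum only when that valuation lies in `𝒮 F`.
    ∑-cong : ∀ xs {f g : A → K} → (∀ {a} → a ∈ xs → f a ≈ g a) → ∑ xs f ≈ ∑ xs g
    ∑-cong []       f≈g = ≈-refl
    ∑-cong (x ∷ xs) f≈g = +-cong (f≈g (here ≡.refl)) (∑-cong xs (f≈g ∘ there))

    ∏-cong : ∀ xs {f g : A → K} → (∀ a → f a ≈ g a) → ∏ xs f ≈ ∏ xs g
    ∏-cong []       f≈g = ≈-refl
    ∏-cong (x ∷ xs) f≈g = *-cong (f≈g x) (∏-cong xs f≈g)

    ∑-0 : ∀ (xs : List A) → ∑ xs (λ _ → 0#) ≈ 0#
    ∑-0 []       = ≈-refl
    ∑-0 (x ∷ xs) = trans (+-identityˡ _) (∑-0 xs)

    ∑-+ : ∀ xs (f g : A → K) → ∑ xs (λ a → f a + g a) ≈ ∑ xs f + ∑ xs g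
    ∑-+ []       f g = sym (+-identityˡ 0#)
    ∑-+ (x ∷ xs) f g = trans (+-congˡ (∑-+ xs f g)) (interchange _ _ _ _)

    ∑-++ : ∀ xs ys (f : A → K) → ∑ (xs ++ ys) f ≈ ∑ xs f + ∑ ys f
    ∑-++ []       ys f = sym (+-identityˡ _)
    ∑-++ (x ∷ xs) ys f = trans (+-congˡ (∑-++ xs ys f)) (sym (+-assoc _ _ _))

    *-distribˡ-∑ : ∀ k xs (f : A → K) → k * ∑ xs f ≈ ∑ xs (λ a → k * f a)
    *-distribˡ-∑ k []       f = zeroʳ k
    *-distribˡ-∑ k (x ∷ xs) f = trans (distribˡ k _ _) (+-congˡ (*-distribˡ-∑ k xs f))

    *-distribʳ-∑ : ∀ k xs (f : A → K) → ∑ xs f * k ≈ ∑ xs (λ a → f a * k)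
    *-distribʳ-∑ k []       f = zeroˡ k
    *-distribʳ-∑ k (x ∷ xs) f = trans (distribʳ k _ _) (+-congˡ (*-distribʳ-∑ k xs f))

    ∑-filter : ∀ {P : A → Set} (P? : Decidable P) xs (f : A → K) →
      ∑ (filter P? xs) f ≈ ∑ xs (λ a → if does (P? a) then f a else 0#)
    ∑-filter P? []       f = ≈-refl
    ∑-filter P? (x ∷ xs) f with does (P? x)
    ... | true  = +-congˡ (∑-filter P? xs f)
    ... | false = trans (∑-filter P? xs f) (sym (+-identityˡ _))

  module _ {A B : Set} where

    ∑-swap : ∀ xs ys (f : A → B → K) →
      ∑ xs (λ a → ∑ ys (f a)) ≈ ∑ ys (λ b → ∑ xs (λ a → f a b))
    ∑-swap []       ys f = sym (∑-0 ys)
    ∑-swap (x ∷ xs) ys f = trans (+-congˡ (∑-swap xs ys f)) (sym (∑-+ ys (f x) _))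

    ∑-cartesianProductWith : ∀ {C : Set} (_∙_ : A → B → C) xs ys (f : C → K) →
      ∑ (cartesianProductWith _∙_ xs ys) f ≈ ∑ xs (λ a → ∑ ys (λ b → f (a ∙ b)))
    ∑-cartesianProductWith _∙_ []       ys f = ≈-refl
    ∑-cartesianProductWith _∙_ (x ∷ xs) ys f = begin
      ∑ (map (x ∙_) ys ++ cartesianProductWith _∙_ xs ys) f
        ≈⟨ ∑-++ (map (x ∙_) ys) _ f ⟩
      ∑ (map (x ∙_) ys) f + ∑ (cartesianProductWith _∙_ xs ys) f
        ≈⟨ +-cong (reflexive (≡.cong (foldr _+_ 0#) (≡.sym (map-∘ ys))))
                  (∑-cartesianProductWith _∙_ xs ys f) ⟩
      ∑ ys (λ b → f (x ∙ b)) + ∑ xs (λ a → ∑ ys (λ b → f (a ∙ b))) ∎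

  restrict : ∀ {P : Set} → Dec P → K → K
  restrict P? a = if does P? then a else 0#

  restrict-yes : ∀ {P : Set} (P? : Dec P) x → P → restrict P? x ≈ x
  restrict-yes (yes _) x p = ≈-refl
  restrict-yes (no ¬p) x p = ⊥-elim (¬p p)

  restrict-no : ∀ {P : Set} (P? : Dec P) x → ¬ P → restrict P? x ≈ 0#
  restrict-no (yes p) x ¬p = ⊥-elim (¬p p)
  restrict-no (no _)  x ¬p = ≈-refl

  -- Total weight of the values followed at one variable.

  module _ (f : D → K) where

    ∑-allD : ∑ allD f ≈ f 𝟘 + f 𝟙 + f ⋆
    ∑-allD = trans (+-congˡ (+-congˡ (+-identityʳ _))) (sym (+-assoc _ _ _))

    -- A star follows only itself, and the booleans of `follows? ⋆ Δ b` compute without inspecting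
    -- `Δ`; it remains to drop zeros.
    ∑-follows-⋆ : ∀ Δ → ∑ allD (λ b → restrict (follows? ⋆ Δ b) (f b)) ≈ f ⋆
    ∑-follows-⋆ Δ = trans (+-identityˡ _) (trans (+-identityˡ _) (+-identityʳ _))

    -- The value `a` always contributes, any other `b` exactly when it is outside `Δ`. Since
    -- `a ∈ Δ`, the filtered sum has no `a`-term, so `f a` is not counted twice.
    ∑-follows-≢⋆ : ∀ {a} Δ → a ≢ ⋆ → a ∈ Δ →
      ∑ allD (λ b → restrict (follows? a Δ b) (f b)) ≈ f a + ∑ (filter (λ b → ¬? (b ∈? Δ)) allD) f
    ∑-follows-≢⋆ {⋆} Δ ⋆≢⋆ _ = ⊥-elim (⋆≢⋆ ≡.refl)
    ∑-follows-≢⋆ {𝟘} Δ _ 𝟘∈Δ = sym (begin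
      f 𝟘 + ∑ (filter ∉Δ? allD) f            ≈⟨ +-congˡ (∑-filter ∉Δ? allD f) ⟩
      f 𝟘 + (g 𝟘 + (g 𝟙 + (g ⋆ + 0#)))        ≈⟨ +-congˡ (+-congʳ (restrict-no (∉Δ? 𝟘) (f 𝟘) (λ 𝟘∉Δ → 𝟘∉Δ 𝟘∈Δ))) ⟩
      f 𝟘 + (0# + (g 𝟙 + (g ⋆ + 0#)))         ≈⟨ +-congˡ (+-identityˡ _) ⟩
      f 𝟘 + (g 𝟙 + (g ⋆ + 0#))                ∎)
      where
      ∉Δ? : Decidable (_∉ Δ)
      ∉Δ? b = ¬? (b ∈? Δ)
      g : D → K
      g b = restrict (∉Δ? b) (f b)
    ∑-follows-≢⋆ {𝟙} Δ _ 𝟙∈Δ = sym (begin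
      f 𝟙 + ∑ (filter ∉Δ? allD) f            ≈⟨ +-congˡ (∑-filter ∉Δ? allD f) ⟩
      -- Moving `f 𝟙` to the second place puts it next to the vanishing term `g 𝟙` that it replaces.
      f 𝟙 + (g 𝟘 + (g 𝟙 + (g ⋆ + 0#)))        ≈⟨ x∙yz≈y∙xz _ _ _ ⟩
      g 𝟘 + (f 𝟙 + (g 𝟙 + (g ⋆ + 0#)))        ≈⟨ +-congˡ (+-congˡ (+-congʳ (restrict-no (∉Δ? 𝟙) (f 𝟙) (λ 𝟙∉Δ → 𝟙∉Δ 𝟙∈Δ)))) ⟩
      g 𝟘 + (f 𝟙 + (0# + (g ⋆ + 0#)))         ≈⟨ +-congˡ (+-congˡ (+-identityˡ _)) ⟩
      g 𝟘 + (f 𝟙 + (g ⋆ + 0#))                ∎)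
      where
      ∉Δ? : Decidable (_∉ Δ)
      ∉Δ? b = ¬? (b ∈? Δ)
      g : D → K
      g b = restrict (∉Δ? b) (f b)

  ∏-allFin-suc : ∀ n (f : Fin (suc n) → K) →
    ∏ (allFin (suc n)) f ≡ f zero * ∏ (allFin n) (f ∘ suc)
  ∏-allFin-suc n f = ≡.cong (λ xs → f zero * foldr _*_ 1# xs)
    (≡.trans (map-tabulate suc f) (≡.sym (map-tabulate (λ x → x) (f ∘ suc))))

  -- Distributivity: expanding the product picks one value per variable, that is, a valuation.
  -- Probabilistically, this is how independence across variables enters. The induction splits off
  -- the first factor, just as `allValuations` splits off the first coordinate.
  ∏-∑ : ∀ n (f : Fin n → D → K) →
    ∏ (allFin n) (λ x → ∑ allD (f x)) ≈ ∑ (allValuations n) (λ r → ∏ (allFin n) (λ x → f x (lookup r x)))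
  ∏-∑ zero    f = sym (+-identityʳ 1#)
  ∏-∑ (suc n) f = begin
    ∏ (allFin (suc n)) (λ x → ∑ allD (f x))
      ≡⟨ ∏-allFin-suc n _ ⟩
    ∑ allD (f zero) * ∏ (allFin n) (λ x → ∑ allD (f (suc x)))
      ≈⟨ *-congˡ (∏-∑ n (f ∘ suc)) ⟩
    ∑ allD (f zero) * ∑ (allValuations n) P
      ≈⟨ *-distribʳ-∑ (∑ (allValuations n) P) allD (f zero) ⟩
    ∑ allD (λ a → f zero a * ∑ (allValuations n) P)
      ≈⟨ ∑-cong allD (λ {a} _ → *-distribˡ-∑ (f zero a) (allValuations n) P) ⟩
    ∑ allD (λ a → ∑ (allValuations n) (λ r → f zero a * P r))
      ≈⟨ ∑-cong allD (λ {a} _ → ∑-cong (allValuations n) (λ {r} _ →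
           reflexive (≡.sym (∏-allFin-suc n (λ x → f x (lookup (a ∷ r) x)))))) ⟩
    ∑ allD (λ a → ∑ (allValuations n) (λ r → ∏ (allFin (suc n)) (λ x → f x (lookup (a ∷ r) x))))
      ≈⟨ ∑-cartesianProductWith _∷_ allD (allValuations n) _ ⟨
    ∑ (allValuations (suc n)) (λ r → ∏ (allFin (suc n)) (λ x → f x (lookup r x))) ∎
    where
    P : Valuation n → K
    P r = ∏ (allFin n) (λ x → f (suc x) (lookup r x))

-- Real numbers

infix 4 _≐_

-- Finer than _≈ᴿ_, but all semiring laws already hold for it.
record _≐_ (x y : ℝ) : Set where
  constructor pointwise
  field at : ∀ k → seq x k ≡ seq y k

open _≐_

≐-isEquivalence : IsEquivalence _≐_
≐-isEquivalence = record
  { refl  = pointwise λ _ → ≡.refl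
  ; sym   = λ p → pointwise λ k → ≡.sym (at p k)
  ; trans = λ p q → pointwise λ k → ≡.trans (at p k) (at q k)
  }

ℝ-commutativeSemiring : CommutativeSemiring _ _
ℝ-commutativeSemiring = record
  { Carrier = ℝ ; _≈_ = _≐_ ; _+_ = _+ᴿ_ ; _*_ = _*ᴿ_ ; 0# = 0ᴿ ; 1# = 1ᴿ
  ; isCommutativeSemiring = Biased.IsCommutativeSemiringˡ.isCommutativeSemiring record
    { +-isCommutativeMonoid = Biased.IsCommutativeMonoidˡ.isCommutativeMonoid record
      { isSemigroup = record
        { isMagma = record
          { isEquivalence = ≐-isEquivalence
          ; ∙-cong = λ p q → pointwise λ k → ≡.cong₂ ℚ._+_ (at p k) (at q k) }
        ; assoc = λ x y z → pointwise λ k → ℚ.+-assoc (seq x k) (seq y k) (seq z k) }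
      ; identityˡ = λ x → pointwise λ k → ℚ.+-identityˡ (seq x k)
      ; comm = λ x y → pointwise λ k → ℚ.+-comm (seq x k) (seq y k) }
    ; *-isCommutativeMonoid = Biased.IsCommutativeMonoidˡ.isCommutativeMonoid record
      { isSemigroup = record
        { isMagma = record
          { isEquivalence = ≐-isEquivalence
          ; ∙-cong = λ p q → pointwise λ k → ≡.cong₂ ℚ._*_ (at p k) (at q k) }
        ; assoc = λ x y z → pointwise λ k → ℚ.*-assoc (seq x k) (seq y k) (seq z k) }
      ; identityˡ = λ x → pointwise λ k → ℚ.*-identityˡ (seq x k)
      ; comm = λ x y → pointwise λ k → ℚ.*-comm (seq x k) (seq y k) }
    ; distribʳ = λ x y z → pointwise λ k → ℚ.*-distribʳ-+ (seq x k) (seq y k) (seq z k)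
    ; zeroˡ = λ x → pointwise λ k → ℚ.*-zeroˡ (seq x k)
    }
  }

open CommutativeSemiring ℝ-commutativeSemiring using (+-identityˡ; +-identityʳ)
  renaming (refl to ≐-refl; sym to ≐-sym)
open ListSums ℝ-commutativeSemiring
open +-*-Solver using (solve; _:=_; _:+_; _:*_; _:-_; :-_; con)

-- The order on the reals.

p≤∣p∣ : ∀ p → p ℚ.≤ ∣ p ∣
p≤∣p∣ p with ℚ.≤-total 0ℚ p
... | inj₁ 0≤p = ℚ.≤-reflexive (≡.sym (ℚ.0≤p⇒∣p∣≡p 0≤p))
... | inj₂ p≤0 = ℚ.≤-trans p≤0 (ℚ.0≤∣p∣ p)

p≤p+ε : ∀ p {ε} → 0ℚ ℚ.< ε → p ℚ.≤ p ℚ.+ ε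
p≤p+ε p {ε} 0<ε = begin
  p          ≡⟨ ℚ.+-identityʳ p ⟨
  p ℚ.+ 0ℚ   ≤⟨ ℚ.+-monoʳ-≤ p (ℚ.<⇒≤ 0<ε) ⟩
  p ℚ.+ ε    ∎
  where open ℚ.≤-Reasoning

½ε>0 : ∀ {ε} → 0ℚ ℚ.< ε → 0ℚ ℚ.< ½ ℚ.* ε
½ε>0 {ε} 0<ε = ℚ.positive⁻¹ (½ ℚ.* ε) {{ℚ.pos*pos⇒pos ½ ε {{positive 0<ε}}}}

½ε+½ε≡ε : ∀ ε → ½ ℚ.* ε ℚ.+ ½ ℚ.* ε ≡ ε
½ε+½ε≡ε ε = ≡.trans (≡.sym (ℚ.*-distribʳ-+ ε ½ ½)) (ℚ.*-identityˡ ε)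

≤ᴿ-reflexive : ∀ {x y} → x ≐ y → x ≤ᴿ y
≤ᴿ-reflexive {x} {y} x≐y ε 0<ε = 0 , λ k _ →
  ℚ.≤-trans (ℚ.≤-reflexive (at x≐y k)) (p≤p+ε (seq y k) 0<ε)

≤ᴿ-trans : ∀ {x y z} → x ≤ᴿ y → y ≤ᴿ z → x ≤ᴿ z
≤ᴿ-trans {x} {y} {z} x≤y y≤z ε 0<ε
  with x≤y (½ ℚ.* ε) (½ε>0 0<ε) | y≤z (½ ℚ.* ε) (½ε>0 0<ε)
... | M , hM | N , hN = M ℕ.⊔ N , λ k k≥ → begin
  seq x k                               ≤⟨ hM k (ℕ.m⊔n≤o⇒m≤o M N k≥) ⟩
  seq y k ℚ.+ ½ ℚ.* ε                   ≤⟨ ℚ.+-monoˡ-≤ (½ ℚ.* ε) (hN k (ℕ.m⊔n≤o⇒n≤o M N k≥)) ⟩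
  (seq z k ℚ.+ ½ ℚ.* ε) ℚ.+ ½ ℚ.* ε     ≡⟨ ℚ.+-assoc (seq z k) _ _ ⟩
  seq z k ℚ.+ (½ ℚ.* ε ℚ.+ ½ ℚ.* ε)     ≡⟨ ≡.cong (seq z k ℚ.+_) (½ε+½ε≡ε ε) ⟩
  seq z k ℚ.+ ε                         ∎
  where open ℚ.≤-Reasoning

≤ᴿ-preorder : Preorder _ _ _
≤ᴿ-preorder = record
  { Carrier = ℝ ; _≈_ = _≐_ ; _≲_ = _≤ᴿ_
  ; isPreorder = record
    { isEquivalence = ≐-isEquivalence
    ; reflexive     = λ {x} {y} → ≤ᴿ-reflexive {x} {y}
    ; trans         = λ {x} {y} {z} → ≤ᴿ-trans {x} {y} {z}
    }
  }

module ≤ᴿ-Reasoning = Relation.Binary.Reasoning.Preorder ≤ᴿ-preorder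

-- The bridge from unitarity, stated with `≈ᴿ`, to the preorder reasoning, whose equality is `≐`.
≈ᴿ⇒≥ᴿ : ∀ x y → x ≈ᴿ y → x ≥ᴿ y
≈ᴿ⇒≥ᴿ x y x≈y ε 0<ε with x≈y ε 0<ε
... | N , hN = N , λ k k≥ → begin
  seq y k                                 ≡⟨ solve 2 (λ p q → q := p :+ :- (p :- q)) ≡.refl (seq x k) (seq y k) ⟩
  seq x k ℚ.+ ℚ.- (seq x k ℚ.- seq y k)   ≤⟨ ℚ.+-monoʳ-≤ (seq x k) (p≤∣p∣ _) ⟩
  seq x k ℚ.+ ∣ ℚ.- (seq x k ℚ.- seq y k) ∣ ≡⟨ ≡.cong (seq x k ℚ.+_) (ℚ.∣-p∣≡∣p∣ (seq x k ℚ.- seq y k)) ⟩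
  seq x k ℚ.+ ∣ seq x k ℚ.- seq y k ∣     ≤⟨ ℚ.+-monoʳ-≤ (seq x k) (ℚ.<⇒≤ (hN k k≥)) ⟩
  seq x k ℚ.+ ε                           ∎
  where open ℚ.≤-Reasoning

+ᴿ-mono-≤ᴿ : ∀ x y u v → x ≤ᴿ y → u ≤ᴿ v → x +ᴿ u ≤ᴿ y +ᴿ v
+ᴿ-mono-≤ᴿ x y u v x≤y u≤v ε 0<ε
  with x≤y (½ ℚ.* ε) (½ε>0 0<ε) | u≤v (½ ℚ.* ε) (½ε>0 0<ε)
... | M , hM | N , hN = M ℕ.⊔ N , λ k k≥ → begin
  seq x k ℚ.+ seq u k
    ≤⟨ ℚ.+-mono-≤ (hM k (ℕ.m⊔n≤o⇒m≤o M N k≥)) (hN k (ℕ.m⊔n≤o⇒n≤o M N k≥)) ⟩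
  (seq y k ℚ.+ ½ ℚ.* ε) ℚ.+ (seq v k ℚ.+ ½ ℚ.* ε)
    ≡⟨ solve 3 (λ p q e → (p :+ e) :+ (q :+ e) := (p :+ q) :+ (e :+ e)) ≡.refl (seq y k) (seq v k) (½ ℚ.* ε) ⟩
  (seq y k ℚ.+ seq v k) ℚ.+ (½ ℚ.* ε ℚ.+ ½ ℚ.* ε)
    ≡⟨ ≡.cong (seq y k ℚ.+ seq v k ℚ.+_) (½ε+½ε≡ε ε) ⟩
  (seq y k ℚ.+ seq v k) ℚ.+ ε ∎
  where open ℚ.≤-Reasoning

divide : ∀ B ε → 0ℚ ℚ.< B → 0ℚ ℚ.< ε → ∃[ δ ] (0ℚ ℚ.< δ × B ℚ.* δ ≡ ε)
divide B ε 0<B 0<ε = ℚ.1/ B ℚ.* ε , ℚ.positive⁻¹ _ {{ℚ.pos*pos⇒pos (ℚ.1/ B) ε}} ,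
  ≡.trans (≡.sym (ℚ.*-assoc B (ℚ.1/ B) ε))
    (≡.trans (≡.cong (ℚ._* ε) (ℚ.*-inverseʳ B)) (ℚ.*-identityˡ ε))
  where
  instance
    _ = positive 0<B
    _ = positive 0<ε
    _ = ℚ.pos⇒nonZero B
    _ = ℚ.1/pos⇒pos B

-- Expand the nonnegative product of `p` and `q + β`; the error `p * β` is at most `A * β`, which is
-- `ε`.
0≤p*q+ε : ∀ {ε A β} p q → 0ℚ ℚ.≤ p → ∣ p ∣ ℚ.≤ A → 0ℚ ℚ.< β → A ℚ.* β ≡ ε →
  0ℚ ℚ.≤ q ℚ.+ β → 0ℚ ℚ.≤ p ℚ.* q ℚ.+ ε
0≤p*q+ε {ε} {A} {β} p q 0≤p p≤A 0<β Aβ≡ε 0≤q+β = begin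
  0ℚ                       ≤⟨ ℚ.nonNegative⁻¹ _ {{ℚ.nonNeg*nonNeg⇒nonNeg p (q ℚ.+ β)}} ⟩
  p ℚ.* (q ℚ.+ β)          ≡⟨ ℚ.*-distribˡ-+ p q β ⟩
  p ℚ.* q ℚ.+ p ℚ.* β      ≤⟨ ℚ.+-monoʳ-≤ (p ℚ.* q) (ℚ.*-monoʳ-≤-nonNeg β (ℚ.≤-trans (p≤∣p∣ p) p≤A)) ⟩
  p ℚ.* q ℚ.+ A ℚ.* β      ≡⟨ ≡.cong (p ℚ.* q ℚ.+_) Aβ≡ε ⟩
  p ℚ.* q ℚ.+ ε            ∎
  where
  open ℚ.≤-Reasoning
  instance
    _ = nonNegative 0≤p
    _ = nonNegative 0≤q+β
    _ = nonNegative (ℚ.<⇒≤ 0<β)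

-- Nonnegative reals may have slightly negative terms. If one factor has a nonnegative term, its
-- bound controls the error caused by the other; if both terms are nonpositive, their product is
-- nonnegative outright.
*ᴿ-nonneg : ∀ x y → x ≥ᴿ 0ᴿ → y ≥ᴿ 0ᴿ → x *ᴿ y ≥ᴿ 0ᴿ
*ᴿ-nonneg x y x≥0 y≥0 ε 0<ε
  with cauchy-bounded {seq x} (cauchy x) | cauchy-bounded {seq y} (cauchy y)
... | A , 0<A , I , x≤A | B , 0<B , J , y≤B
  -- The tolerance for each factor is scaled by the bound on the other: `β` is used for `y`, `α` for
  -- `x`.
  with divide A ε 0<A 0<ε | divide B ε 0<B 0<ε
... | β , 0<β , Aβ≡ε | α , 0<α , Bα≡ε
  with x≥0 α 0<α | y≥0 β 0<β
... | M , hM | N , hN = (I ℕ.⊔ J) ℕ.⊔ (M ℕ.⊔ N) , λ k k≥ →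
  let k≥IJ = ℕ.m⊔n≤o⇒m≤o (I ℕ.⊔ J) (M ℕ.⊔ N) k≥
      k≥MN = ℕ.m⊔n≤o⇒n≤o (I ℕ.⊔ J) (M ℕ.⊔ N) k≥
  in bound k (x≤A k (ℕ.m⊔n≤o⇒m≤o I J k≥IJ)) (y≤B k (ℕ.m⊔n≤o⇒n≤o I J k≥IJ))
             (hM k (ℕ.m⊔n≤o⇒m≤o M N k≥MN)) (hN k (ℕ.m⊔n≤o⇒n≤o M N k≥MN))
  where
  bound : ∀ k → ∣ seq x k ∣ ℚ.≤ A → ∣ seq y k ∣ ℚ.≤ B →
    0ℚ ℚ.≤ seq x k ℚ.+ α → 0ℚ ℚ.≤ seq y k ℚ.+ β → 0ℚ ℚ.≤ seq x k ℚ.* seq y k ℚ.+ ε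
  bound k ∣x∣≤A ∣y∣≤B 0≤x+α 0≤y+β with ℚ.≤-total 0ℚ (seq x k) | ℚ.≤-total 0ℚ (seq y k)
  ... | inj₁ 0≤x | _        = 0≤p*q+ε (seq x k) (seq y k) 0≤x ∣x∣≤A 0<β Aβ≡ε 0≤y+β
  ... | inj₂ _   | inj₁ 0≤y = ≡.subst (λ p → 0ℚ ℚ.≤ p ℚ.+ ε) (ℚ.*-comm (seq y k) (seq x k))
    (0≤p*q+ε (seq y k) (seq x k) 0≤y ∣y∣≤B 0<α Bα≡ε 0≤x+α)
  ... | inj₂ x≤0 | inj₂ y≤0 = ℚ.≤-trans
    (ℚ.nonNegative⁻¹ _ {{ℚ.nonPos*nonPos⇒nonPos (seq x k) {{nonPositive x≤0}} (seq y k) {{nonPositive y≤0}}}})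
    (p≤p+ε (seq x k ℚ.* seq y k) 0<ε)

-- Write `x * y` as `(x + y - 1) + (x - 1) * (y - 1)`: the first summand is at least 1 and the
-- second is nonnegative.
1≤x*y : ∀ x y → 1ᴿ ≤ᴿ x → 1ᴿ ≤ᴿ y → 1ᴿ ≤ᴿ x *ᴿ y
1≤x*y x y 1≤x 1≤y = begin
  1ᴿ                                    ≈⟨ pointwise (λ _ → ≡.refl) ⟩
  (1ᴿ +ᴿ 1ᴿ -ᴿ1) +ᴿ 0ᴿ                  ≲⟨ +ᴿ-mono-≤ᴿ (1ᴿ +ᴿ 1ᴿ -ᴿ1) (x +ᴿ y -ᴿ1) 0ᴿ ((x -ᴿ1) *ᴿ (y -ᴿ1))
                                             (-ᴿ1-mono (1ᴿ +ᴿ 1ᴿ) (x +ᴿ y) (+ᴿ-mono-≤ᴿ 1ᴿ x 1ᴿ y 1≤x 1≤y))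
                                             (*ᴿ-nonneg (x -ᴿ1) (y -ᴿ1) (-ᴿ1-mono 1ᴿ x 1≤x) (-ᴿ1-mono 1ᴿ y 1≤y)) ⟩
  (x +ᴿ y -ᴿ1) +ᴿ (x -ᴿ1) *ᴿ (y -ᴿ1)    ≈⟨ pointwise (λ k → solve 2 (λ p q →
                                             (p :+ q :+ con (ℚ.- 1ℚ)) :+ (p :+ con (ℚ.- 1ℚ)) :* (q :+ con (ℚ.- 1ℚ)) := p :* q)
                                             ≡.refl (seq x k) (seq y k)) ⟩
  x *ᴿ y                                ∎
  where
  open ≤ᴿ-Reasoning
  infixl 6 _-ᴿ1
  _-ᴿ1 : ℝ → ℝ
  z -ᴿ1 = z +ᴿ fromℚ (ℚ.- 1ℚ)
  -ᴿ1-mono : ∀ u v → u ≤ᴿ v → u -ᴿ1 ≤ᴿ v -ᴿ1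
  -ᴿ1-mono u v u≤v = +ᴿ-mono-≤ᴿ u v (fromℚ (ℚ.- 1ℚ)) (fromℚ (ℚ.- 1ℚ)) u≤v (≤ᴿ-reflexive {fromℚ (ℚ.- 1ℚ)} ≐-refl)

-- Inequalities for finite sums and products.

module _ {A : Set} where

  ∏-nonneg : ∀ xs (f : A → ℝ) → (∀ a → f a ≥ᴿ 0ᴿ) → ∏ xs f ≥ᴿ 0ᴿ
  ∏-nonneg []       f f≥0 = λ ε 0<ε → 0 , λ _ _ → ℚ.<⇒≤ (ℚ.+-mono-< (ℚ.positive⁻¹ 1ℚ) 0<ε)
  ∏-nonneg (x ∷ xs) f f≥0 = *ᴿ-nonneg (f x) (∏ xs f) (f≥0 x) (∏-nonneg xs f f≥0)

  1≤∏ : ∀ xs (f : A → ℝ) → (∀ a → 1ᴿ ≤ᴿ f a) → 1ᴿ ≤ᴿ ∏ xs f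
  1≤∏ []       f 1≤f = ≤ᴿ-reflexive {1ᴿ} ≐-refl
  1≤∏ (x ∷ xs) f 1≤f = 1≤x*y (f x) (∏ xs f) (1≤f x) (1≤∏ xs f 1≤f)

  ∑-mono-≤ᴿ : ∀ xs (f g : A → ℝ) → (∀ a → f a ≤ᴿ g a) → ∑ xs f ≤ᴿ ∑ xs g
  ∑-mono-≤ᴿ []       f g f≤g = ≤ᴿ-reflexive {0ᴿ} ≐-refl
  ∑-mono-≤ᴿ (x ∷ xs) f g f≤g = +ᴿ-mono-≤ᴿ (f x) (g x) (∑ xs f) (∑ xs g) (f≤g x) (∑-mono-≤ᴿ xs f g f≤g)

  ∑-nonneg : ∀ xs (f : A → ℝ) → (∀ a → f a ≥ᴿ 0ᴿ) → ∑ xs f ≥ᴿ 0ᴿ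
  ∑-nonneg xs f f≥0 = begin
    0ᴿ               ≈⟨ ∑-0 xs ⟨
    ∑ xs (λ _ → 0ᴿ)  ≲⟨ ∑-mono-≤ᴿ xs (λ _ → 0ᴿ) f f≥0 ⟩
    ∑ xs f           ∎
    where open ≤ᴿ-Reasoning

  term≤∑ : ∀ {xs a} (f : A → ℝ) → (∀ a → f a ≥ᴿ 0ᴿ) → a ∈ xs → f a ≤ᴿ ∑ xs f
  term≤∑ {x ∷ xs} f f≥0 (here ≡.refl) = begin
    f x             ≈⟨ +-identityʳ (f x) ⟨
    f x +ᴿ 0ᴿ       ≲⟨ +ᴿ-mono-≤ᴿ (f x) (f x) 0ᴿ (∑ xs f) (≤ᴿ-reflexive {f x} ≐-refl) (∑-nonneg xs f f≥0) ⟩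
    f x +ᴿ ∑ xs f   ∎
    where open ≤ᴿ-Reasoning
  term≤∑ {x ∷ xs} {a} f f≥0 (there a∈xs) = begin
    f a             ≈⟨ +-identityˡ (f a) ⟨
    0ᴿ +ᴿ f a       ≲⟨ +ᴿ-mono-≤ᴿ 0ᴿ (f x) (f a) (∑ xs f) (f≥0 x) (term≤∑ f f≥0 a∈xs) ⟩
    f x +ᴿ ∑ xs f   ∎
    where open ≤ᴿ-Reasoning

-- Compatible valuations

∈-allD : ∀ a → a ∈ allD
∈-allD 𝟘 = here ≡.refl
∈-allD 𝟙 = there (here ≡.refl)
∈-allD ⋆ = there (there (here ≡.refl))

∈-allValuations : ∀ {n} (σ : Valuation n) → σ ∈ allValuations n
∈-allValuations []      = here ≡.refl
∈-allValuations (a ∷ σ) = ∈-cartesianProductWith⁺ _∷_ (∈-allD a) (∈-allValuations σ)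

module _ {n} (F : CNF n) where

  valid⇒∈𝒮 : ∀ {σ} → Valid F σ → σ ∈ 𝒮 F
  valid⇒∈𝒮 {σ} = ∈-filter⁺ (valid? F) (∈-allValuations σ)

  -- A valid `σ` is its own witness, so its weights never fall into the zero case of `ω`.
  lookup∈A : ∀ {σ} x → σ ∈ 𝒮 F → lookup σ x ∈ A F σ x
  lookup∈A {σ} x σ∈𝒮 =
    ∈-map⁺ (λ τ → lookup τ x) (∈-filter⁺ (agreeOff? x σ) σ∈𝒮 (λ _ _ → ≡.refl))

  ∈A⇒valid : ∀ {σ x b} → b ∈ A F σ x → ∃[ τ ] (Valid F τ × AgreeOff x σ τ × lookup τ x ≡ b)
  ∈A⇒valid {σ} {x} b∈A with ∈-map⁻ (λ τ → lookup τ x) b∈A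
  ... | τ , τ∈ , b≡ with ∈-filter⁻ (agreeOff? x σ) {xs = 𝒮 F} τ∈
  ... | τ∈𝒮 , agree =
    τ , proj₂ (∈-filter⁻ (valid? F) {xs = allValuations n} τ∈𝒮) , agree , ≡.sym b≡

hamming : ∀ {n} → Valuation n → Valuation n → ℕ
hamming []      []      = 0
hamming (a ∷ σ) (b ∷ r) = (if does (a ≟ᴰ b) then 0 else 1) ℕ.+ hamming σ r

lookup-injective : ∀ {n} (σ τ : Valuation n) → (∀ x → lookup σ x ≡ lookup τ x) → σ ≡ τ
lookup-injective σ τ σ≗τ = ≡.trans (≡.sym (Vec.tabulate∘lookup σ))
  (≡.trans (Vec.tabulate-cong σ≗τ) (Vec.tabulate∘lookup τ))

-- At `x` a disagreement disappears; everywhere else `σ` and `τ` coincide, so their contributions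
-- are equal.
hamming-decreases : ∀ {n} x (σ τ r : Valuation n) → AgreeOff x σ τ →
  lookup τ x ≡ lookup r x → lookup σ x ≢ lookup r x → hamming τ r ℕ.< hamming σ r
hamming-decreases zero (a ∷ σ) (c ∷ τ) (b ∷ r) agree ≡.refl a≢b
  -- Splitting on both decisions makes the head contributions compute to 0 and 1; agreement off the
  -- head identifies the tails.
  with c ≟ᴰ c | a ≟ᴰ c | lookup-injective τ σ (λ y → agree (suc y) λ ())
... | no c≢c | _       | _      = ⊥-elim (c≢c ≡.refl)
... | yes _  | yes a≡c | _      = ⊥-elim (a≢b a≡c)
... | yes _  | no _    | ≡.refl = ℕ.≤-refl
hamming-decreases (suc x) (a ∷ σ) (c ∷ τ) (b ∷ r) agree τx≡rx σx≢rx
  with agree zero (λ ())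
... | ≡.refl = ℕ.+-monoʳ-< (if does (a ≟ᴰ b) then 0 else 1)
  (hamming-decreases x σ τ r (λ y y≢x → agree (suc y) (y≢x ∘ Fin.suc-injective)) τx≡rx σx≢rx)

-- Relaxing a boolean solution towards the draw.

Compatible : ∀ {n} → CNF n → Valuation n → Valuation n → Set
Compatible F r σ = ∀ x → Follows (lookup σ x) (A F σ x) (lookup r x)

-- The loop invariant. It settles the case that `Follows` would reject: a starred variable whose
-- drawn value is inadmissible.
StarsWithin : ∀ {n} → Valuation n → Valuation n → Set
StarsWithin r σ = ∀ x → lookup σ x ≡ ⋆ → lookup r x ≡ ⋆

module _ {n} (F : CNF n) (r : Valuation n) where

  relax : ∀ σ → Acc ℕ._<_ (hamming σ r) → Valid F σ → StarsWithin r σ →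
    ∃[ τ ] (Valid F τ × Compatible F r τ)
  relax σ (acc rec) σ-valid stars
    with Fin.all? (λ x → lookup σ x ≟ᴰ lookup r x ⊎-dec ¬? (lookup r x ∈? A F σ x))
  ... | yes settled = σ , σ-valid , compatible
    where
    compatible : Compatible F r σ
    compatible x with settled x | lookup σ x ≟ᴰ ⋆
    ... | inj₁ σx≡rx | _        = inj₁ σx≡rx
    -- By the invariant the draw is also a star here, so the first alternative of `Follows` applies.
    ... | inj₂ _     | yes σx≡⋆ = inj₁ (≡.trans σx≡⋆ (≡.sym (stars x σx≡⋆)))
    ... | inj₂ rx∉A  | no σx≢⋆  = inj₂ (σx≢⋆ , rx∉A)
  ... | no ¬settled
    with x , ¬settledₓ ← Fin.¬∀⟶∃¬ n _
           (λ x → lookup σ x ≟ᴰ lookup r x ⊎-dec ¬? (lookup r x ∈? A F σ x)) ¬settled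
    -- An unsettled `x` only refutes that the drawn value is outside `A F σ x`; decidability of
    -- membership turns this into membership, hence into a valid `τ`.
    with τ , τ-valid , agree , τx≡rx ←
           ∈A⇒valid F {σ} {x} (decidable-stable (lookup r x ∈? A F σ x) (¬settledₓ ∘ inj₂))
    = relax τ (rec (hamming-decreases x σ τ r agree τx≡rx (¬settledₓ ∘ inj₁))) τ-valid τ-stars
    where
    τ-stars : StarsWithin r τ
    τ-stars y τy≡⋆ with y Fin.≟ x
    -- The changed variable now carries the drawn value itself, so a star there is a star of `r`.
    ... | yes ≡.refl = ≡.trans (≡.sym τx≡rx) τy≡⋆
    ... | no y≢x     = stars y (≡.trans (≡.sym (agree y y≢x)) τy≡⋆)

  compatible-exists : ∃[ σ ] BooleanSolution F σ → ∃[ τ ] (Valid F τ × Compatible F r τ)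
  compatible-exists (σ , σ-valid , boolean) = relax σ (<-wellFounded _) σ-valid λ x σx≡⋆ →
    ⊥-elim ([ (λ σx≡𝟘 → 𝟘≢⋆ (≡.trans (≡.sym σx≡𝟘) σx≡⋆))
            , (λ σx≡𝟙 → 𝟙≢⋆ (≡.trans (≡.sym σx≡𝟙) σx≡⋆)) ]′ (boolean x))
    where
    𝟘≢⋆ : 𝟘 ≢ ⋆
    𝟘≢⋆ ()
    𝟙≢⋆ : 𝟙 ≢ ⋆
    𝟙≢⋆ ()

-- Weights as probabilities

restrict-nonneg : ∀ {P : Set} (P? : Dec P) x → x ≥ᴿ 0ᴿ → restrict P? x ≥ᴿ 0ᴿ
restrict-nonneg (yes _) x x≥0 = x≥0
restrict-nonneg (no _)  x x≥0 = ≤ᴿ-reflexive {0ᴿ} ≐-refl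

module _ {n} (s : WeightingSeed n) where

  -- An inductive view, because stating the values of ω as equations would make
  -- with-abstraction normalise the Cauchy proofs inside _+ᴿ_.
  data ω-Value (x : Fin n) (a : D) (Δ : List D) : ℝ → Set where
    star : a ≡ ⋆ → ω-Value x a Δ (weight s x a)
    bool : a ≢ ⋆ →
      ω-Value x a Δ (weight s x a +ᴿ sumᴿ (map (weight s x) (filter (λ b → ¬? (b ∈? Δ)) allD)))

  ω-value : ∀ x a Δ → a ∈ Δ → ω-Value x a Δ (ω s x a Δ)
  ω-value x a Δ a∈Δ with a ∈? Δ | a ≟ᴰ ⋆
  ... | yes _  | yes a≡⋆ = star a≡⋆
  ... | yes _  | no a≢⋆  = bool a≢⋆
  ... | no a∉Δ | _       = ⊥-elim (a∉Δ a∈Δ)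

  ω-Value⇒∑ : ∀ {x a Δ z} → ω-Value x a Δ z → a ∈ Δ →
    z ≐ ∑ allD (λ b → restrict (follows? a Δ b) (weight s x b))
  ω-Value⇒∑ {x} {Δ = Δ} (star ≡.refl) _ = ≐-sym (∑-follows-⋆ (weight s x) Δ)
  ω-Value⇒∑ {x} {Δ = Δ} (bool a≢⋆) a∈Δ = ≐-sym (∑-follows-≢⋆ (weight s x) Δ a≢⋆ a∈Δ)

-- Expected number of compatible valid valuations.

theorem18 : ∀ (n : ℕ) (F : CNF n) (s : WeightingSeed n) → Unitary s →
    (∃[ σ ] BooleanSolution F σ) → γ F s ≥ᴿ 1ᴿ
theorem18 n F s unitary solution = begin
  1ᴿ
    ≲⟨ 1≤∏ X (λ x → ∑ allD (weight s x)) total≥1 ⟩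
  ∏ X (λ x → ∑ allD (weight s x))
    ≈⟨ ∏-∑ n (weight s) ⟩
  ∑ V (λ r → ∏ X (λ x → weight s x (lookup r x)))
    -- For each `r`, one compatible valid valuation already accounts for the whole probability of
    -- `r`.
    ≲⟨ ∑-mono-≤ᴿ V _ _ prob≤ ⟩
  ∑ V (λ r → ∑ (𝒮 F) (λ σ → joint σ r))
    ≈⟨ ∑-swap V (𝒮 F) (λ r σ → joint σ r) ⟩
  ∑ (𝒮 F) (λ σ → ∑ V (joint σ))
    -- With `σ` fixed, compatibility is a condition on each variable separately, so the sum over
    -- draws factors again.
    ≈⟨ ∑-cong (𝒮 F) (λ {σ} _ → ∏-∑ n (part σ)) ⟨
  ∑ (𝒮 F) (λ σ → ∏ X (λ x → ∑ allD (part σ x)))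
    ≈⟨ ∑-cong (𝒮 F) (λ {σ} σ∈𝒮 → ∏-cong X (λ x →
         ω-Value⇒∑ s (ω-value s x (lookup σ x) (A F σ x) (lookup∈A F x σ∈𝒮)) (lookup∈A F x σ∈𝒮))) ⟨
  γ F s ∎
  where
  open ≤ᴿ-Reasoning
  X = allFin n
  V = allValuations n
  part : Valuation n → Fin n → D → ℝ
  part σ x b = restrict (follows? (lookup σ x) (A F σ x) b) (weight s x b)
  -- The product of the indicators in `part` makes this the probability of `r` if `r` is compatible
  -- with `σ`, and zero otherwise.
  joint : Valuation n → Valuation n → ℝ
  joint σ r = ∏ X (λ x → part σ x (lookup r x))
  total≥1 : ∀ x → 1ᴿ ≤ᴿ ∑ allD (weight s x)
  total≥1 x = begin
    1ᴿ
      ≲⟨ ≈ᴿ⇒≥ᴿ (weight s x 𝟘 +ᴿ weight s x 𝟙 +ᴿ weight s x ⋆) 1ᴿ (unitary x) ⟩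
    weight s x 𝟘 +ᴿ weight s x 𝟙 +ᴿ weight s x ⋆
      ≈⟨ ∑-allD (weight s x) ⟨
    ∑ allD (weight s x) ∎
  joint≥0 : ∀ r σ → joint σ r ≥ᴿ 0ᴿ
  joint≥0 r σ = ∏-nonneg X _ λ x →
    restrict-nonneg (follows? (lookup σ x) (A F σ x) (lookup r x)) (weight s x (lookup r x))
      (nonneg s x (lookup r x))
  prob≤-compatible : ∀ r τ → Valid F τ → Compatible F r τ →
    ∏ X (λ x → weight s x (lookup r x)) ≤ᴿ ∑ (𝒮 F) (λ σ → joint σ r)
  prob≤-compatible r τ τ-valid compatible = begin
    ∏ X (λ x → weight s x (lookup r x))
      ≈⟨ ∏-cong X (λ x → restrict-yes (follows? (lookup τ x) (A F τ x) (lookup r x))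
           (weight s x (lookup r x)) (compatible x)) ⟨
    joint τ r
      ≲⟨ term≤∑ {a = τ} (λ σ → joint σ r) (joint≥0 r) (valid⇒∈𝒮 F τ-valid) ⟩
    ∑ (𝒮 F) (λ σ → joint σ r) ∎
  prob≤ : ∀ r → ∏ X (λ x → weight s x (lookup r x)) ≤ᴿ ∑ (𝒮 F) (λ σ → joint σ r)
  prob≤ r = let τ , τ-valid , compatible = compatible-exists F r solution
            in prob≤-compatible r τ τ-valid compatible
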